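{- Let $K$ be a simplicial complex over a type $E$, let $s \in K$ be a face, let $x \in E$ with $x \notin V(K)$, and let $\sigma_s K$ be the stellar subdivision of $K$ at $s$ with barycenter $x$. Then \[ \big(K \setminus \mathrm{St}(K,s)\big) \cap \big(\mathrm{Lk}(K,s) \star \partial s \star \{x\}\big) = \mathrm{Lk}(K,s) \star \partial s = \mathrm{Lk}(\sigma_s K, \{x\}). \]
   Context: A simplicial complex over a type (set) $E$ is a set $K$ of nonempty finite subsets of $E$ (its faces) such that every nonempty subset of a face is a face. It may be empty or infinite, and not every element of $E$ need be a vertex. Intersections and unions of complexes are those of their sets of faces. $V(K) = \{x \in E \mid \{x\} \in K\}$. For a finite set $s \subseteq E$: the link is $\mathrm{Lk}(K,s) = \{t \in K \mid s \cup t \in K,\ s \cap t = \emptyset\}$; the boundary is $\partial s = \{t \subseteq s \mid t \ne \emptyset,\ t \neq s\}$; the star complement, written $K \setminus \mathrm{St}(K,s)$, is $\{t \in K \mid s \not\subseteq t\}$. For complexes $A, B$ over $E$ with disjoint vertex sets, $A \star B$ (regarded as a complex over $E$) has as faces all nonempty sets $a \cup b$ with $a \in A \cup \{\emptyset\}$, $b \in B \cup \{\emptyset\}$. For $s \in K$ and $x \in E \setminus V(K)$, the stellar subdivision of $K$ at $s$ with barycenter $x$ is $\sigma_s K = (K \setminus \mathrm{St}(K,s)) \cup (\mathrm{Lk}(K,s) \star \partial s \star \{x\})$, where $\{x\}$ denotes the complex with single face $\{x\}$. That is, the faces of $\sigma_s K$ are the faces of $K$ not containing $s$ together with all nonempty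 sets $a \cup b \cup c$ with $a \in \mathrm{Lk}(K,s) \cup \{\emptyset\}$, $b \in \partial s \cup \{\emptyset\}$, $c \in \{\emptyset, \{x\}\}$. -}

module Defs where

open import Level using (Level; _⊔_)
open import Data.List.Base using (List; []; _∷_; [_]; _++_)
open import Data.List.Membership.Propositional using (_∈_)
open import Data.List.Membership.Propositional.Properties using (∈-++⁻; ∈-++⁺ˡ; ∈-++⁺ʳ)
open import Data.List.Relation.Unary.Any using (here; there)
open import Data.List.Relation.Binary.Subset.Propositional using (_⊆_)
open import Data.List.Relation.Binary.Subset.Propositional.Properties
  using (⊆[]⇒≡[]; ⊆-trans; ++⁺; ++⁺ʳ)
open import Data.List.Relation.Binary.Disjoint.Propositional using (Disjoint)
open import Data.List.Relation.Binary.BagAndSetEquality using (_∼[_]_; set)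
open import Data.Product.Base using (_×_; _,_; proj₁; proj₂; ∃₂)
open import Data.Sum.Base using (_⊎_; inj₁; inj₂; [_,_]′)
open import Function.Base using (_∘_)
open import Function.Bundles using (Equivalence; mk⇔)
open import Relation.Binary.PropositionalEquality.Core using (_≡_; _≢_; refl)
open import Relation.Nullary.Negation.Core using (¬_; contradiction)
open import Relation.Unary using (Pred) renaming (_≐_ to _≐ᴾ_)

private
  variable
    e ℓ ℓ₁ ℓ₂ : Level
    E : Set e

-- A finite subset of E is represented by a list of its elements, in any order
-- and with repetitions allowed.  Two lists represent the same finite set when
-- t ≐ u, i.e. when they have the same members; no decidable equality on E is
-- needed.  Under this representation t ∪ u is t ++ u, inclusion is _⊆_,
-- t ∩ u = ∅ is Disjoint t u, and t = ∅ is t ≡ [].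

FinSet : Set e → Set e
FinSet = List

infix 4 _≐_

_≐_ : FinSet E → FinSet E → Set _
t ≐ u = t ∼[ set ] u

-- Being a face does not depend on the list chosen to represent a finite set:
-- this is the instance u ≐ t of `downClosed` (see `Face-resp-≐`).

record SimplicialComplex (E : Set e) (ℓ : Level) : Set (e ⊔ Level.suc ℓ) where
  field
    Face       : Pred (FinSet E) ℓ
    nonempty   : ∀ {t} → Face t → t ≢ []
    downClosed : ∀ {t u} → Face t → u ⊆ t → u ≢ [] → Face u

open SimplicialComplex public

private
  variable
    t u v : FinSet E

≐⇒⊆ : t ≐ u → t ⊆ u
≐⇒⊆ t≐u = Equivalence.to t≐u

≐⇒⊇ : t ≐ u → u ⊆ t
≐⇒⊇ t≐u = Equivalence.from t≐u

⊆-antisym : t ⊆ u → u ⊆ t → t ≐ u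
⊆-antisym t⊆u u⊆t = mk⇔ t⊆u u⊆t

⊆-nonempty : t ⊆ u → t ≢ [] → u ≢ []
⊆-nonempty t⊆u t≢[] refl = t≢[] (⊆[]⇒≡[] t⊆u)

Face-resp-≐ : (K : SimplicialComplex E ℓ) → t ≐ u → Face K t → Face K u
Face-resp-≐ K t≐u t∈K =
  downClosed K t∈K (≐⇒⊇ t≐u) (⊆-nonempty (≐⇒⊆ t≐u) (nonempty K t∈K))

infix  4 _≈_
infixr 7 _∩_
infixr 6 _∪_

_≈_ : SimplicialComplex E ℓ₁ → SimplicialComplex E ℓ₂ → Set _
A ≈ B = Face A ≐ᴾ Face B

_∩_ : SimplicialComplex E ℓ₁ → SimplicialComplex E ℓ₂ → SimplicialComplex E (ℓ₁ ⊔ ℓ₂)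
A ∩ B = record
  { Face       = λ t → Face A t × Face B t
  ; nonempty   = λ (t∈A , _) → nonempty A t∈A
  ; downClosed = λ (t∈A , t∈B) u⊆t u≢[] →
      downClosed A t∈A u⊆t u≢[] , downClosed B t∈B u⊆t u≢[]
  }

_∪_ : SimplicialComplex E ℓ₁ → SimplicialComplex E ℓ₂ → SimplicialComplex E (ℓ₁ ⊔ ℓ₂)
A ∪ B = record
  { Face       = λ t → Face A t ⊎ Face B t
  ; nonempty   = [ nonempty A , nonempty B ]′
  ; downClosed = λ
      { (inj₁ t∈A) u⊆t u≢[] → inj₁ (downClosed A t∈A u⊆t u≢[])
      ; (inj₂ t∈B) u⊆t u≢[] → inj₂ (downClosed B t∈B u⊆t u≢[])
      }
  }

V : SimplicialComplex E ℓ → Pred E ℓ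
V K x = Face K [ x ]

Lk : SimplicialComplex E ℓ → FinSet E → SimplicialComplex E _
Lk K s = record
  { Face       = λ t → Face K t × Face K (s ++ t) × Disjoint s t
  ; nonempty   = λ (t∈K , _) → nonempty K t∈K
  ; downClosed = λ (t∈K , st∈K , s#t) u⊆t u≢[] →
        downClosed K t∈K u⊆t u≢[]
      , downClosed K st∈K (++⁺ʳ s u⊆t) (⊆-nonempty (∈-++⁺ʳ s) u≢[])
      , λ (y∈s , y∈u) → s#t (y∈s , u⊆t y∈u)
  }

infix 9 ∂_

∂_ : FinSet E → SimplicialComplex E _
∂ s = record
  { Face       = λ t → t ⊆ s × t ≢ [] × ¬ t ≐ s
  ; nonempty   = λ (_ , t≢[] , _) → t≢[]
  ; downClosed = λ (t⊆s , _ , t≉s) u⊆t u≢[] →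
        ⊆-trans u⊆t t⊆s
      , u≢[]
      , λ u≐s → t≉s (⊆-antisym t⊆s (⊆-trans (≐⇒⊇ u≐s) u⊆t))
  }

infix 8 _∖St_

_∖St_ : SimplicialComplex E ℓ → FinSet E → SimplicialComplex E _
K ∖St s = record
  { Face       = λ t → Face K t × ¬ s ⊆ t
  ; nonempty   = λ (t∈K , _) → nonempty K t∈K
  ; downClosed = λ (t∈K , s⊈t) u⊆t u≢[] →
      downClosed K t∈K u⊆t u≢[] , λ s⊆u → s⊈t (⊆-trans s⊆u u⊆t)
  }

⁅_⁆ : E → SimplicialComplex E _
⁅ x ⁆ = record
  { Face       = λ t → t ≐ [ x ]
  ; nonempty   = λ t≐x → ⊆-nonempty (≐⇒⊇ t≐x) λ ()
  ; downClosed = λ t≐x u⊆t u≢[] → ⊆[x]⇒≐[x] (⊆-trans u⊆t (≐⇒⊆ t≐x)) u≢[]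
  }
  where
  ⊆[x]⇒≐[x] : ∀ {x : E} {u} → u ⊆ [ x ] → u ≢ [] → u ≐ [ x ]
  ⊆[x]⇒≐[x] {u = []}    _   u≢[] = contradiction refl u≢[]
  ⊆[x]⇒≐[x] {u = y ∷ u} u⊆x _ with u⊆x (here refl)
  ... | here refl = ⊆-antisym u⊆x λ { (here refl) → here refl }

Face∪∅ : SimplicialComplex E ℓ → Pred (FinSet E) _
Face∪∅ A t = Face A t ⊎ t ≡ []

Face∪∅-downClosed : (A : SimplicialComplex E ℓ) → Face∪∅ A t → u ⊆ t → Face∪∅ A u
Face∪∅-downClosed {u = []}    A _           _   = inj₂ refl
Face∪∅-downClosed {u = _ ∷ _} A (inj₁ t∈A)  u⊆t = inj₁ (downClosed A t∈A u⊆t λ ())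
Face∪∅-downClosed {u = _ ∷ _} A (inj₂ refl) u⊆t = contradiction (u⊆t (here refl)) λ ()

⊆-split : ∀ (a b : FinSet E) u → u ⊆ a ++ b → ∃₂ λ a′ b′ → a′ ⊆ a × b′ ⊆ b × u ≐ a′ ++ b′
⊆-split a b [] _ = [] , [] , (λ ()) , (λ ()) , ⊆-antisym (λ ()) (λ ())
⊆-split a b (y ∷ u) yu⊆ab
  with ⊆-split a b u (yu⊆ab ∘ there) | ∈-++⁻ a (yu⊆ab (here refl))
... | a′ , b′ , a′⊆a , b′⊆b , u≐ | inj₁ y∈a =
  y ∷ a′ , b′ , (λ { (here refl) → y∈a ; (there p) → a′⊆a p }) , b′⊆b ,
  ⊆-antisym (λ { (here refl) → here refl ; (there p) → there (≐⇒⊆ u≐ p) })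
            (λ { (here refl) → here refl ; (there p) → there (≐⇒⊇ u≐ p) })
... | a′ , b′ , a′⊆a , b′⊆b , u≐ | inj₂ y∈b =
  a′ , y ∷ b′ , a′⊆a , (λ { (here refl) → y∈b ; (there p) → b′⊆b p }) ,
  ⊆-antisym (λ { (here refl) → ∈-++⁺ʳ a′ (here refl)
               ; (there p)   → insert (∈-++⁻ a′ (≐⇒⊆ u≐ p)) })
            (λ p → delete (∈-++⁻ a′ p))
  where
  insert : ∀ {z} → z ∈ a′ ⊎ z ∈ b′ → z ∈ a′ ++ y ∷ b′
  insert (inj₁ p) = ∈-++⁺ˡ p
  insert (inj₂ p) = ∈-++⁺ʳ a′ (there p)
  delete : ∀ {z} → z ∈ a′ ⊎ z ∈ y ∷ b′ → z ∈ y ∷ u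
  delete (inj₁ p)           = there (≐⇒⊇ u≐ (∈-++⁺ˡ p))
  delete (inj₂ (here refl)) = here refl
  delete (inj₂ (there p))   = there (≐⇒⊇ u≐ (∈-++⁺ʳ a′ p))

-- The join is only meant for complexes with disjoint vertex sets.  The formula
-- makes sense in general, so that is not required as an argument;
-- `Lk-∂-disjoint` and `Lk⋆∂-⁅x⁆-disjoint` show that it holds for the joins
-- appearing in a stellar subdivision.

infixl 8 _⋆_

_⋆_ : SimplicialComplex E ℓ₁ → SimplicialComplex E ℓ₂ → SimplicialComplex E _
A ⋆ B = record
  { Face       = λ t → t ≢ [] × ∃₂ λ a b → Face∪∅ A a × Face∪∅ B b × t ≐ a ++ b
  ; nonempty   = λ (t≢[] , _) → t≢[]
  ; downClosed = λ (_ , a , b , a∈A , b∈B , t≐ab) u⊆t u≢[] →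
      let a′ , b′ , a′⊆a , b′⊆b , u≐a′b′ = ⊆-split a b _ (⊆-trans u⊆t (≐⇒⊆ t≐ab))
      in u≢[] , a′ , b′
       , Face∪∅-downClosed A a∈A a′⊆a , Face∪∅-downClosed B b∈B b′⊆b , u≐a′b′
  }

-- Meant for s a face of K and x not a vertex of K.

stellar : SimplicialComplex E ℓ → FinSet E → E → SimplicialComplex E _
stellar K s x = K ∖St s ∪ Lk K s ⋆ ∂ s ⋆ ⁅ x ⁆

DisjointVertices : SimplicialComplex E ℓ₁ → SimplicialComplex E ℓ₂ → Set _
DisjointVertices A B = ∀ x → ¬ (V A x × V B x)

Lk-∂-disjoint : (K : SimplicialComplex E ℓ) (s : FinSet E) → DisjointVertices (Lk K s) (∂ s)
Lk-∂-disjoint K s x ((_ , _ , s#x) , (x⊆s , _)) = s#x (x⊆s (here refl) , here refl)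

Lk⋆∂-⁅x⁆-disjoint : (K : SimplicialComplex E ℓ) (s : FinSet E) (x : E) →
                    Face K s → ¬ V K x → DisjointVertices (Lk K s ⋆ ∂ s) ⁅ x ⁆
Lk⋆∂-⁅x⁆-disjoint K s x s∈K x∉V y ((_ , a , b , a∈ , b∈ , y≐ab) , y≐x)
  with ≐⇒⊆ y≐x (here refl)
... | here refl = case (∈-++⁻ a (≐⇒⊆ y≐ab (here refl))) a∈ b∈
  where
  vertex : ∀ {t} → Face K t → ¬ x ∈ t
  vertex t∈K x∈t = x∉V (downClosed K t∈K (λ { (here refl) → x∈t }) λ ())
  case : x ∈ a ⊎ x ∈ b → Face∪∅ (Lk K s) a → ¬ Face∪∅ (∂ s) b
  case (inj₁ x∈a) (inj₁ (a∈K , _)) _                = vertex a∈K x∈a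
  case (inj₁ ())  (inj₂ refl)      _
  case (inj₂ x∈b) _                (inj₁ (b⊆s , _)) = vertex s∈K (b⊆s x∈b)
  case (inj₂ ())  _                (inj₂ refl)

{-# OPTIONS --safe #-}
-- A face of Lk(K,s) ⋆ ∂s is a ∪ b with a disjoint from s and b a proper subset
-- of s; it lies in s ∪ a ∈ K, and it cannot contain s since s ⊆ a ∪ b would
-- force s ⊆ b.  So Lk(K,s) ⋆ ∂s ⊆ K ∖ St(K,s), and none of its faces contains x.
-- Conversely, a nonempty set avoiding x and lying in a face of A ⋆ {x} is a face
-- of A; this settles the intersection directly, and the link because no face of
-- K ∖ St(K,s) contains x.
module Submission where

open import Defs
open import Level using (Level)
open import Data.List.Base using ([]; _∷_; [_]; _++_)
open import Data.List.Membership.Propositional using (_∈_; _∉_)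
open import Data.List.Membership.Propositional.Properties using (∈-++⁻; ∈-++⁺ˡ; ∈-++⁺ʳ)
open import Data.List.Properties using (++-identityʳ)
open import Data.List.Relation.Binary.Disjoint.Propositional using (Disjoint)
open import Data.List.Relation.Binary.Subset.Propositional using (_⊆_)
open import Data.List.Relation.Binary.Subset.Propositional.Properties using (⊆[]⇒≡[]; ⊆-refl; ⊆-reflexive; ⊆-trans)
open import Data.List.Relation.Unary.Any using (here; there)
open import Data.Product.Base using (_×_; _,_; proj₁)
open import Data.Sum.Base using (inj₁; inj₂)
open import Function.Base using (_∘_)
open import Relation.Binary.PropositionalEquality.Core using (_≢_; refl)
open import Relation.Nullary.Negation.Core using (¬_; contradiction)

private
  variable
    e ℓ ℓ₁ ℓ₂ : Level
    E : Set e
    s t u v : FinSet E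
    x : E

⊆-++-Disjointˡ : Disjoint t u → t ⊆ u ++ v → t ⊆ v
⊆-++-Disjointˡ {u = u} t#u t⊆uv y∈t with ∈-++⁻ u (t⊆uv y∈t)
... | inj₁ y∈u = contradiction (y∈t , y∈u) t#u
... | inj₂ y∈v = y∈v

⊆-++-Disjointʳ : Disjoint t v → t ⊆ u ++ v → t ⊆ u
⊆-++-Disjointʳ {u = u} t#v t⊆uv y∈t with ∈-++⁻ u (t⊆uv y∈t)
... | inj₁ y∈u = y∈u
... | inj₂ y∈v = contradiction (y∈t , y∈v) t#v

∈Face⇒∈V : (K : SimplicialComplex E ℓ) → Face K t → x ∈ t → V K x
∈Face⇒∈V K t∈K x∈t = downClosed K t∈K (λ { (here refl) → x∈t }) λ ()

Face∪∅⇒Face : (K : SimplicialComplex E ℓ) → Face∪∅ K t → t ≢ [] → Face K t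
Face∪∅⇒Face K (inj₁ t∈K)  _    = t∈K
Face∪∅⇒Face K (inj₂ t≡[]) t≢[] = contradiction t≡[] t≢[]

⋆-inˡ : (A : SimplicialComplex E ℓ₁) (B : SimplicialComplex E ℓ₂) → Face A t → Face (A ⋆ B) t
⋆-inˡ {t = t} A B t∈A =
  nonempty A t∈A , t , [] , inj₁ t∈A , inj₂ refl ,
  ⊆-antisym ∈-++⁺ˡ (⊆-reflexive (++-identityʳ t))

-- The face is written `x ∷ t` because `[ x ] ++ t`, the form that `Lk` at `[ x ]` asks for,
-- computes to it.
⋆-cone : (A : SimplicialComplex E ℓ) → Face A t → Face (A ⋆ ⁅ x ⁆) (x ∷ t)
⋆-cone {t = t} {x = x} A t∈A =
  (λ ()) , t , [ x ] , inj₁ t∈A , inj₁ (⊆-antisym ⊆-refl ⊆-refl) ,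
  ⊆-antisym (λ { (here refl) → ∈-++⁺ʳ t (here refl) ; (there p) → ∈-++⁺ˡ p }) from
  where
  from : t ++ [ x ] ⊆ x ∷ t
  from p with ∈-++⁻ t p
  ... | inj₁ y∈t         = there y∈t
  ... | inj₂ (here refl) = here refl

-- The part `c` of `u` has no member but `x`, so `t` misses it and lies in `a`. Keeping `u` apart
-- from `t` lets the intersection take `u = t` and the link take `u = x ∷ t`.
⋆-cone⁻ : (A : SimplicialComplex E ℓ) → Face (A ⋆ ⁅ x ⁆) u → t ⊆ u → t ≢ [] → x ∉ t → Face A t
⋆-cone⁻ {x = x} {t = t} A (_ , a , c , a∈ , c∈ , u≐ac) t⊆u t≢[] x∉t =
  Face∪∅⇒Face A (Face∪∅-downClosed A a∈ (⊆-++-Disjointʳ (t#c c∈) (⊆-trans t⊆u (≐⇒⊆ u≐ac)))) t≢[]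
  where
  t#c : Face∪∅ ⁅ x ⁆ c → Disjoint t c
  t#c (inj₁ c≐x) (y∈t , y∈c) with ≐⇒⊆ c≐x y∈c
  ... | here refl = x∉t y∈t
  t#c (inj₂ refl) (_ , ())

Lk⋆∂⊆∖St : (K : SimplicialComplex E ℓ) → Face K s → Face (Lk K s ⋆ ∂ s) t → Face (K ∖St s) t
Lk⋆∂⊆∖St {s = s} {t = t} K s∈K (t≢[] , a , b , a∈ , b∈ , t≐ab) =
  t∈K a∈ , λ s⊆t → s⊈b b∈ (⊆-++-Disjointˡ (s#a a∈) (⊆-trans s⊆t (≐⇒⊆ t≐ab)))
  where
  b⊆s : Face∪∅ (∂ s) b → b ⊆ s
  b⊆s (inj₁ (b⊆s , _)) = b⊆s
  b⊆s (inj₂ refl)      = λ ()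

  s⊈b : Face∪∅ (∂ s) b → ¬ s ⊆ b
  s⊈b (inj₁ (b⊆s , _ , b≉s)) s⊆b = b≉s (⊆-antisym b⊆s s⊆b)
  -- With `b` empty, properness in `s` comes from `s` being nonempty, as a face of `K`.
  s⊈b (inj₂ refl)            s⊆b = nonempty K s∈K (⊆[]⇒≡[] s⊆b)

  s#a : Face∪∅ (Lk K s) a → Disjoint s a
  s#a (inj₁ (_ , _ , s#a)) = s#a
  s#a (inj₂ refl)          = λ { (_ , ()) }

  t⊆sa : t ⊆ s ++ a
  t⊆sa y∈t with ∈-++⁻ a (≐⇒⊆ t≐ab y∈t)
  ... | inj₁ y∈a = ∈-++⁺ʳ s y∈a
  ... | inj₂ y∈b = ∈-++⁺ˡ (b⊆s b∈ y∈b)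

  t∈K : Face∪∅ (Lk K s) a → Face K t
  t∈K (inj₁ (_ , sa∈K , _)) = downClosed K sa∈K t⊆sa t≢[]
  -- With `a` empty there is no link face to supply `s ++ a`; it is `s` itself, a face by `s∈K`.
  t∈K (inj₂ refl)           =
    downClosed K s∈K (⊆-trans t⊆sa (⊆-reflexive (++-identityʳ s))) t≢[]

theorem3p8 : ∀ {e ℓ : Level} (E : Set e) (K : SimplicialComplex E ℓ)
    (s : FinSet E) → Face K s → (x : E) → ¬ (V K x) →
    (((K ∖St s) ∩ (Lk K s ⋆ ∂ s ⋆ ⁅ x ⁆)) ≈ (Lk K s ⋆ ∂ s))
    × ((Lk K s ⋆ ∂ s) ≈ Lk (stellar K s x) [ x ])
theorem3p8 E K s s∈K x x∉V =
    ( (λ ((t∈K , _) , t∈J⋆x) → ⋆-cone⁻ J t∈J⋆x ⊆-refl (nonempty K t∈K) (x∉V ∘ ∈Face⇒∈V K t∈K))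
    , (λ t∈J → Lk⋆∂⊆∖St K s∈K t∈J , ⋆-inˡ J ⁅ x ⁆ t∈J) )
  -- Both `t` and `x ∷ t` are found in the cone summand of `stellar`; `x ∉ t` since `t` is also a
  -- face of `K`.
  , ( (λ t∈J → inj₂ (⋆-inˡ J ⁅ x ⁆ t∈J) , inj₂ (⋆-cone J t∈J) ,
         λ { (here refl , x∈t) → x∉V (∈Face⇒∈V K (proj₁ (Lk⋆∂⊆∖St K s∈K t∈J)) x∈t) })
    , link⊆J )
  where
  J = Lk K s ⋆ ∂ s

  link⊆J : ∀ {t} → Face (Lk (stellar K s x) [ x ]) t → Face J t
  -- A face `x ∷ t` of `K` would make `x` a vertex, so only the cone summand remains.
  link⊆J (_   , inj₁ (xt∈K , _) , _)   = contradiction (∈Face⇒∈V K xt∈K (here refl)) x∉V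
  link⊆J (t∈σ , inj₂ xt∈J⋆x     , x#t) =
    ⋆-cone⁻ J xt∈J⋆x there (nonempty (stellar K s x) t∈σ) λ x∈t → x#t (here refl , x∈t)
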